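{- Let $\Delta,k$ be integers with $k\ge 1$ odd and $\Delta\ge 4k+1$. Then there is a gadget $G_{\Delta,k}$, i.e. a realizable instance of $\Delta$-$k$-DiTTR (so that $D_{u,v}\ge\hat d(u,v)+k$ for all $u,v$), that enforces $\lambda(v_1,v_2)=\lambda(v_2,v_1)$ for some pair of adjacent vertices $(v_1,v_2)$. Moreover, for any even $k$ with $\Delta\ge 4k+5$, the gadget $G_{\Delta,k+1}$ for $k+1$ is also such a gadget for slack $k$, i.e. a realizable instance of $\Delta$-$k$-DiTTR enforcing $\lambda(v_1,v_2)=\lambda(v_2,v_1)$ for some pair of adjacent vertices.
   Context: All graphs are finite. A $\Delta$-periodic labeling of a directed graph $G=(V,E)$ is a map $\lambda:E\to\{0,1,\dots,\Delta-1\}$; edge $e$ is then active exactly at the times $\lambda(e)+i\Delta$, $i\in\mathbb{N}_0$. A temporal $s$-$z$-path is a sequence $(v_{i-1},v_i,t_i)_{i=1}^{\ell}$ with $v_0=s$, $v_\ell=z$, pairwise distinct vertices $v_0,\dots,v_\ell$, $(v_{i-1},v_i)\in E$ active at time $t_i$ for every $i$, and $t_1<t_2<\dots<t_\ell$ (strictly increasing). Its duration is $t_\ell+1-t_1$. A fastest temporal path is one of minimum duration. $\hat d(u,v)$ is the distance from $u$ to $v$ in the static graph $G$ (all edges have unit length). A bidirected tree is the directed graph obtained from an undirected tree by replacing each edge $\{u,v\}$ by the two directed edges $(u,v),(v,u)$ (which may get different labels). For integers $\Delta\ge1,k\ge0$, an instance of $\Delta$-$k$-DiTTR consists of a bidirected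 tree $G=(V,E)$ and a matrix $D$ indexed by $V\times V$ with entries positive integers or $\infty$ (no restriction) such that $D_{u,v}\ge\hat d(u,v)+k$ for all $u,v$. A valid labeling is a $\Delta$-periodic labeling $\lambda$ of $E$ such that, for all $u,v\in V$, the duration of a fastest temporal path from $u$ to $v$ is at most $D_{u,v}$; the instance is realizable if a valid labeling exists. Diagonal entries of $D$ play no role; all conditions on $D$ are for distinct vertices. An instance enforces $\lambda(v_1,v_2)=\lambda(v_2,v_1)$ if this equality holds for every valid labeling $\lambda$. -}

module Defs where

open import Data.Bool using (Bool; T)
open import Data.Fin using (Fin; zero; suc; fromℕ; inject₁; toℕ)
import Data.Fin as Fin
open import Data.Nat using (ℕ; suc; _+_; _*_; _∸_; _≤_; _<_; NonZero)
open import Data.Product using (∃-syntax; _×_)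
open import Data.Unit using (⊤)
open import Function.Definitions using (Injective)
open import Relation.Binary.PropositionalEquality using (_≡_; _≢_)
open import Relation.Nullary using (¬_)

record Digraph : Set where
  field
    order : ℕ
    arc   : Fin order → Fin order → Bool

  Vertex : Set
  Vertex = Fin order

  -- Via T, a pair of vertices carries at most one arc (T is proof irrelevant).
  Arc : Vertex → Vertex → Set
  Arc u v = T (arc u v)

record Path (G : Digraph) (s z : Digraph.Vertex G) (ℓ : ℕ) : Set where
  open Digraph G
  field
    vertex   : Fin (suc ℓ) → Vertex
    start    : vertex zero ≡ s
    end      : vertex (fromℕ ℓ) ≡ z
    distinct : Injective _≡_ _≡_ vertex
    arcs     : ∀ i → Arc (vertex (inject₁ i)) (vertex (suc i))

IsDistance : (G : Digraph) → Digraph.Vertex G → Digraph.Vertex G → ℕ → Set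
IsDistance G u v d = Path G u v d × (∀ {ℓ} → Path G u v ℓ → d ≤ ℓ)

Labeling : ℕ → Digraph → Set
Labeling Δ G = ∀ u v → Digraph.Arc G u v → Fin Δ

module _ {Δ : ℕ} {G : Digraph} (lab : Labeling Δ G) where
  open Digraph G

  Active : ∀ {u v} → Arc u v → ℕ → Set
  Active {u} {v} e t = ∃[ i ] t ≡ toℕ (lab u v e) + i * Δ

  -- Only paths with at least one arc: the duration of an empty path is
  -- undefined, and such a path joins a vertex to itself.
  record TemporalPath (s z : Vertex) : Set where
    field
      {ℓ-1} : ℕ
      path  : Path G s z (suc ℓ-1)
      time  : Fin (suc ℓ-1) → ℕ
    open Path path public
    field
      active     : ∀ i → Active (arcs i) (time i)
      increasing : ∀ {i j} → i Fin.< j → time i < time j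

    -- increasing gives time zero ≤ time (fromℕ ℓ-1), so ∸ never truncates.
    duration : ℕ
    duration = (time (fromℕ ℓ-1) + 1) ∸ time zero

  open TemporalPath using (duration)

  IsFastest : ∀ {s z} → TemporalPath s z → Set
  IsFastest {s} {z} p = (q : TemporalPath s z) → duration p ≤ duration q

  FastestDurationAtMost : Vertex → Vertex → ℕ → Set
  FastestDurationAtMost u v d =
    ∃[ p ] IsFastest {u} {v} p × duration p ≤ d

record Graph : Set where
  field
    order : ℕ
    edge  : Fin order → Fin order → Bool
    symm  : ∀ {u v} → T (edge u v) → T (edge v u)
    irrefl : ∀ {v} → ¬ T (edge v v)

bidirected : Graph → Digraph
bidirected G = record { order = order ; arc = edge }
  where open Graph G

record IsTree (G : Graph) : Set where
  open Digraph (bidirected G)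
  field
    nonEmpty  : NonZero order
    connected : ∀ u v → ∃[ ℓ ] Path (bidirected G) u v ℓ
    -- A cycle is a path with at least three vertices whose ends are adjacent.
    acyclic   : ∀ {u v ℓ} → Path (bidirected G) u v ℓ → 2 ≤ ℓ → ¬ Arc v u

data ℕ⁺∞ : Set where
  fin : (d : ℕ) → .{{NonZero d}} → ℕ⁺∞
  ∞   : ℕ⁺∞

_≤∞_ : ℕ → ℕ⁺∞ → Set
m ≤∞ fin d = m ≤ d
m ≤∞ ∞     = ⊤

-- A bidirected tree with a matrix of bounds. The slack k and the period Δ are
-- kept out of the data, so that the same instance can be considered for
-- different values of k.
record Instance : Set where
  field
    graph  : Graph
    isTree : IsTree graph

  digraph : Digraph
  digraph = bidirected graph

  open Digraph digraph public
  open Graph graph public using (symm)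

  field
    D : Vertex → Vertex → ℕ⁺∞

module _ (I : Instance) where
  open Instance I

  -- Not vacuous: the tree is connected, so d exists (and it is unique).
  HasSlack : ℕ → Set
  HasSlack k = ∀ u v → u ≢ v → ∀ d → IsDistance digraph u v d → (d + k) ≤∞ D u v

  -- ∞ imposes no restriction; in a bidirected tree every pair of distinct
  -- vertices is joined by a temporal path, so nothing is lost there.
  Respects : ∀ {Δ} → Labeling Δ digraph → Vertex → Vertex → ℕ⁺∞ → Set
  Respects lab u v (fin d) = FastestDurationAtMost lab u v d
  Respects lab u v ∞       = ⊤

  IsValid : ∀ {Δ} → Labeling Δ digraph → Set
  IsValid lab = ∀ u v → u ≢ v → Respects lab u v (D u v)

  Realizable : ℕ → Set
  Realizable Δ = ∃[ lab ] IsValid {Δ} lab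

  EnforcesEqual : ℕ → (v₁ v₂ : Vertex) → Arc v₁ v₂ → Set
  EnforcesEqual Δ v₁ v₂ e =
    (lab : Labeling Δ digraph) → IsValid lab → lab v₁ v₂ e ≡ lab v₂ v₁ (symm e)

  IsGadget : (Δ k : ℕ) → Set
  IsGadget Δ k =
    HasSlack k ×
    Realizable Δ ×
    ∃[ v₁ ] ∃[ v₂ ] ∃[ e ] EnforcesEqual Δ v₁ v₂ e

{-# OPTIONS --safe #-}
module Submission where

-- The tree is a path p₀ … p_k with two extra leaves x, x′ at p₀ and y, y′ at
-- p_k.  Only four bounds are finite, each with slack exactly k: x → y, y′ → x′
-- (length k + 2) and x → x′, y′ → y (length 2).  Paths in a tree are unique, so
-- a bound limits the total waiting along one fixed sequence of arcs.  Let a, b be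
-- the labels of the two arcs of the middle edge, which exists as k is odd.
-- Comparing y′ → y with the parts y′ → b and a → y of the long paths gives
-- b - a ≡ P mod Δ, where P is the waiting on these two parts plus the slack left
-- unused by y′ → y; symmetrically a - b ≡ Q from x → x′.  Both are nonnegative
-- and P + Q ≤ 4k < Δ because the long paths wait at most k each, so P = Q = 0.
-- Conversely the labels 0, 1, …, k + 1 along both long paths meet all bounds.

open import Data.Bool using (Bool; true; false; T; _∨_; if_then_else_)
open import Data.Bool.Properties using (T-∨; T-≡; T-irrelevant)
open import Data.Fin using (Fin; zero; suc; toℕ; fromℕ; fromℕ<; inject₁; opposite; _≟_)
import Data.Fin as Fin
open import Data.Fin.Induction using (<-weakInduction; <-weakInduction-startingFrom)
open import Data.Fin.Properties using (toℕ-injective; toℕ<n; toℕ-fromℕ; toℕ-fromℕ<; toℕ-inject₁; opposite-involutive; ≤fromℕ)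
import Data.Fin.Properties as Fin
open import Data.Nat using (ℕ; zero; suc; _+_; _*_; _∸_; _≤_; _<_; z≤n; s≤s; s≤s⁻¹; _≡ᵇ_; NonZero; >-nonZero)
open import Data.Nat.Divisibility using (_∣_; _∤_; divides; >⇒∤; ∣m+n∣m⇒∣n; n∣m*n)
open import Data.Nat.DivMod using (_%_; [m+kn]%n≡m%n; m<n⇒m%n≡m)
open import Data.Nat.Properties hiding (_≟_)
open import Data.Nat.Tactic.RingSolver using (solve-∀)
open import Data.Product using (Σ-syntax; ∃-syntax; _×_; _,_; proj₁; proj₂)
open import Data.Sum using (_⊎_; inj₁; inj₂; swap; [_,_]′)
import Data.Sum as Sum
open import Data.Unit using (tt)
open import Function using (_∘_)
open import Function.Bundles using (module Equivalence)
open import Relation.Binary.Definitions using (tri<; tri≈; tri>)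
open import Relation.Binary.PropositionalEquality
open import Relation.Nullary using (¬_; contradiction; yes; no)
open import Defs

-- Paths and orientations

opposite-inject₁ : ∀ {n} (i : Fin n) → opposite (inject₁ i) ≡ suc (opposite i)
opposite-inject₁ zero    = refl
opposite-inject₁ (suc i) = cong inject₁ (opposite-inject₁ i)

opposite-fromℕ : ∀ n → opposite (fromℕ n) ≡ zero
opposite-fromℕ zero    = refl
opposite-fromℕ (suc n) = cong inject₁ (opposite-fromℕ n)

module _ {G : Digraph} where
  open Digraph G
  open Path

  trivialPath : ∀ u → Path G u u 0
  trivialPath u = record
    { vertex   = λ _ → u
    ; start    = refl
    ; end      = refl
    ; distinct = λ { {zero} {zero} _ → refl }
    ; arcs     = λ ()
    }

  prepend : ∀ {u v w ℓ} → Arc u v → (p : Path G v w ℓ) →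
            (∀ i → u ≢ vertex p i) → Path G u w (suc ℓ)
  prepend {u} e p fresh = record
    { vertex   = λ { zero → u ; (suc i) → vertex p i }
    ; start    = refl
    ; end      = end p
    ; distinct = λ { {zero}  {zero}  _  → refl
                   ; {zero}  {suc j} eq → contradiction eq (fresh j)
                   ; {suc i} {zero}  eq → contradiction (sym eq) (fresh i)
                   ; {suc i} {suc j} eq → cong suc (distinct p eq) }
    ; arcs     = λ { zero    → subst (Arc u) (sym (start p)) e
                   ; (suc i) → arcs p i }
    }

  reverse : (∀ {u v} → Arc u v → Arc v u) →
            ∀ {u v ℓ} → Path G u v ℓ → Path G v u ℓ
  reverse arc-sym {ℓ = ℓ} p = record
    { vertex   = vertex p ∘ opposite
    ; start    = end p
    ; end      = trans (cong (vertex p) (opposite-fromℕ ℓ)) (start p)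
    ; distinct = λ {i} {j} eq →
        trans (sym (opposite-involutive i))
              (trans (cong opposite (distinct p eq)) (opposite-involutive j))
    ; arcs     = λ i → subst (λ j → Arc (vertex p j) (vertex p (inject₁ (opposite i))))
                             (sym (opposite-inject₁ i)) (arc-sym (arcs p (opposite i)))
    }

  -- The parent function acts on numbers instead of vertices, so that a root can have its parent
  -- outside the graph.
  OrientedBy : (ℕ → ℕ) → Set
  OrientedBy f = ∀ {u v} → Arc u v → f (toℕ u) ≡ toℕ v ⊎ f (toℕ v) ≡ toℕ u

  module _ (f : ℕ → ℕ) where

    Up Down : ∀ {s z ℓ} → Path G s z ℓ → Fin ℓ → Set
    Up   p i = f (toℕ (vertex p (inject₁ i))) ≡ toℕ (vertex p (suc i))
    Down p i = f (toℕ (vertex p (suc i))) ≡ toℕ (vertex p (inject₁ i))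

    module _ (oriented : OrientedBy f) where

      -- A step up right after a step down would return to the only parent, which is the vertex just
      -- left.
      down-persists : ∀ {s z ℓ} (p : Path G s z (suc ℓ)) {i j} →
                      Down p i → i Fin.≤ j → Down p j
      down-persists p downᵢ = <-weakInduction-startingFrom (Down p) downᵢ next-down
        where
        i≢2+i : ∀ {n} (i : Fin n) → inject₁ (inject₁ i) ≢ suc (suc i)
        i≢2+i (suc i) eq = i≢2+i i (Fin.suc-injective eq)

        next-down : ∀ i → Down p (inject₁ i) → Down p (suc i)
        next-down i down with oriented (arcs p (suc i))
        ... | inj₂ down′ = down′
        ... | inj₁ up    = contradiction
          (distinct p (toℕ-injective (trans (sym down) up))) (i≢2+i i)

      -- A path that ever leaves a vertex for one of its children could not
      -- end in the root.
      path-to-root-up : ∀ {s z ℓ} → order ≤ f (toℕ z) →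
                        (p : Path G s z ℓ) → ∀ i → Up p i
      path-to-root-up {z = z} {ℓ = suc ℓ} root p i with oriented (arcs p i)
      ... | inj₁ up   = up
      ... | inj₂ down = contradiction (≤-trans root (≤-reflexive parent-of-z))
                                      (<⇒≱ (toℕ<n (vertex p (inject₁ (fromℕ ℓ)))))
        where
        parent-of-z : f (toℕ z) ≡ toℕ (vertex p (inject₁ (fromℕ ℓ)))
        parent-of-z = trans (cong (f ∘ toℕ) (sym (end p)))
                            (down-persists p down (≤fromℕ i))

-- Trees given by a parent function that increases the vertex number

-- Vertex `n` is the root, since its parent exceeds `n`; from every other vertex the parents climb
-- to it in increasing steps.
module ParentTree (n : ℕ) (f : ℕ → ℕ) (f-inc : ∀ u → u < f u)
                  (f-bound : ∀ {u} → u < n → f u ≤ n) where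

  parentEdge : Fin (suc n) → Fin (suc n) → Bool
  parentEdge u v = (f (toℕ u) ≡ᵇ toℕ v) ∨ (f (toℕ v) ≡ᵇ toℕ u)

  edge⇒parent : ∀ {u v} → T (parentEdge u v) → f (toℕ u) ≡ toℕ v ⊎ f (toℕ v) ≡ toℕ u
  edge⇒parent {u} {v} e =
    Sum.map (≡ᵇ⇒≡ (f (toℕ u)) (toℕ v)) (≡ᵇ⇒≡ (f (toℕ v)) (toℕ u)) (Equivalence.to T-∨ e)

  parent⇒edge : ∀ {u v} → f (toℕ u) ≡ toℕ v ⊎ f (toℕ v) ≡ toℕ u → T (parentEdge u v)
  parent⇒edge {u} {v} s =
    Equivalence.from T-∨ (Sum.map (≡⇒≡ᵇ (f (toℕ u)) (toℕ v)) (≡⇒≡ᵇ (f (toℕ v)) (toℕ u)) s)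

  parentEdge-sym : ∀ {u v} → T (parentEdge u v) → T (parentEdge v u)
  parentEdge-sym {u} {v} e = parent⇒edge {v} {u} (swap (edge⇒parent {u} {v} e))

  graph : Graph
  graph = record
    { order  = suc n
    ; edge   = parentEdge
    ; symm   = λ {u} {v} → parentEdge-sym {u} {v}
    ; irrefl = λ {v} e → [ f≢ v , f≢ v ]′ (edge⇒parent {v} {v} e)
    }
    where
    f≢ : ∀ v → f (toℕ v) ≢ toℕ v
    f≢ v eq = <⇒≢ (f-inc (toℕ v)) (sym eq)

  open Digraph (bidirected graph)
  open Path

  private
    G = bidirected graph

  oriented : OrientedBy {G} f
  oriented {u} {v} = edge⇒parent {u} {v}

  up-increases : ∀ {u v : Vertex} → f (toℕ u) ≡ toℕ v → toℕ u < toℕ v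
  up-increases {u} eq = <-≤-trans (f-inc (toℕ u)) (≤-reflexive eq)

  all-up⇒≤ : ∀ {s z ℓ} (p : Path G s z ℓ) → (∀ i → Up f p i) → toℕ s ≤ toℕ z
  all-up⇒≤ {s} {z} {ℓ} p up =
    subst₂ (λ a b → toℕ a ≤ toℕ b) (start p) (end p)
      (<-weakInduction (λ i → toℕ (vertex p zero) ≤ toℕ (vertex p i)) ≤-refl
        (λ i le → ≤-trans le (<⇒≤ (up-increases (up i)))) (fromℕ ℓ))

  all-down⇒≥ : ∀ {s z ℓ} (p : Path G s z ℓ) → (∀ i → Down f p i) → toℕ z ≤ toℕ s
  all-down⇒≥ {s} {z} {ℓ} p down =
    subst₂ (λ a b → toℕ a ≤ toℕ b) (end p) (start p)
      (<-weakInduction (λ i → toℕ (vertex p i) ≤ toℕ (vertex p zero)) ≤-refl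
        (λ i le → ≤-trans (<⇒≤ (up-increases (down i))) le) (fromℕ ℓ))

  -- The arc between the ends joins one of them to its parent. Either the path also visits this
  -- parent right next to that end, and a vertex repeats, or the vertex numbers are monotone along
  -- the whole path, against the order of the ends.
  acyclic : ∀ {u v ℓ} → Path G u v ℓ → 2 ≤ ℓ → ¬ Arc v u
  acyclic {ℓ = 1} _ (s≤s ())
  acyclic {u} {v} {suc (suc ℓ)} p _ e = [ v-up , u-up ]′ (oriented {v} {u} e)
    where
    last = fromℕ (suc ℓ)

    v-up : ¬ f (toℕ v) ≡ toℕ u
    v-up v→u with oriented (arcs p last)
    ... | inj₂ down = contradiction
      (distinct p (toℕ-injective
        (trans (cong toℕ (start p))
          (trans (sym v→u) (trans (cong (f ∘ toℕ) (sym (end p))) down)))))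
      (λ ())
    ... | inj₁ up = <⇒≱ (up-increases {v} {u} v→u) (all-up⇒≤ p all-up)
      where
      all-up : ∀ i → Up f p i
      all-up i with oriented (arcs p i)
      ... | inj₁ upᵢ  = upᵢ
      ... | inj₂ down = contradiction
        (up-increases {vertex p (suc last)} (down-persists f oriented p down (≤fromℕ i)))
        (<⇒≯ (up-increases {vertex p (inject₁ last)} up))

    u-up : ¬ f (toℕ u) ≡ toℕ v
    u-up u→v with oriented (arcs p zero)
    ... | inj₁ up   = contradiction
      (distinct p (toℕ-injective
        (trans (sym up) (trans (cong (f ∘ toℕ) (start p))
          (trans u→v (cong toℕ (sym (end p))))))))
      (λ ())
    ... | inj₂ down = <⇒≱ (up-increases {u} {v} u→v)
      (all-down⇒≥ p (λ i → down-persists f oriented p down z≤n))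

  -- The path between u and v never visits a number below both of them, so
  -- the smaller end can always be attached to the path of its parent.
  pathAbove : ∀ m (u v : Vertex) → (n ∸ toℕ u) + (n ∸ toℕ v) ≤ m →
              ∃[ ℓ ] Σ[ p ∈ Path G u v ℓ ]
                (∀ w → w ≤ toℕ u → w ≤ toℕ v → ∀ i → w ≤ toℕ (vertex p i))
  extendBelow : ∀ m (u v : Vertex) → (n ∸ toℕ u) + (n ∸ toℕ v) ≤ m → toℕ u < toℕ v →
                ∃[ ℓ ] Σ[ p ∈ Path G u v ℓ ] (∀ i → toℕ u ≤ toℕ (vertex p i))

  pathAbove m u v le with <-cmp (toℕ u) (toℕ v)
  ... | tri≈ _ eq _ rewrite toℕ-injective eq = 0 , trivialPath v , λ _ w≤ _ _ → w≤
  ... | tri< u<v _ _ = let ℓ , p , above = extendBelow m u v le u<v in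
    ℓ , p , λ _ w≤ _ i → ≤-trans w≤ (above i)
  ... | tri> _ _ v<u =
    let ℓ , p , above = extendBelow m v u (subst (_≤ m) (+-comm (n ∸ toℕ u) _) le) v<u in
    ℓ , reverse (λ {a} {b} → parentEdge-sym {a} {b}) p , λ _ _ w≤ i → ≤-trans w≤ (above (opposite i))

  extendBelow m u v le u<v with n ∸ toℕ u in n∸u
  ... | zero = contradiction (<-≤-trans u<v (s≤s⁻¹ (toℕ<n v))) (≤⇒≯ (m∸n≡0⇒m≤n n∸u))
  extendBelow (suc m) u v (s≤s le) u<v | suc d =
    let ℓ , p , above = pathAbove m u⁺ v smaller
        -- `suc (toℕ u)` is at most both ends of the path from the parent, so that path avoids `u`.
        u<p = above (suc (toℕ u)) (≤-trans (f-inc _) (≤-reflexive (sym toℕ-u⁺))) u<v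
    in suc ℓ , prepend (parent⇒edge {u} {u⁺} (inj₁ (sym toℕ-u⁺))) p (λ i eq → <⇒≢ (u<p i) (cong toℕ eq))
       , λ { zero → ≤-refl ; (suc i) → <⇒≤ (u<p i) }
    where
    u<n : toℕ u < n
    u<n = <-≤-trans u<v (s≤s⁻¹ (toℕ<n v))
    u⁺ : Vertex
    u⁺ = fromℕ< (s≤s (f-bound u<n))
    toℕ-u⁺ : toℕ u⁺ ≡ f (toℕ u)
    toℕ-u⁺ = toℕ-fromℕ< (s≤s (f-bound u<n))
    n∸u⁺ : n ∸ toℕ u⁺ ≤ d
    n∸u⁺ = s≤s⁻¹ (≤-trans
      (∸-monoʳ-< (≤-trans (f-inc _) (≤-reflexive (sym toℕ-u⁺))) (s≤s⁻¹ (toℕ<n u⁺)))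
      (≤-reflexive n∸u))
    smaller : (n ∸ toℕ u⁺) + (n ∸ toℕ v) ≤ m
    smaller = ≤-trans (+-monoˡ-≤ _ n∸u⁺) le

  isTree : IsTree graph
  isTree = record
    { nonEmpty  = _
    ; connected = λ u v → let ℓ , p , _ = pathAbove _ u v ≤-refl in ℓ , p
    ; acyclic   = acyclic
    }

-- Congruence modulo the period

module Congruence (Δ : ℕ) where

  infix 4 _≋_

  -- Multiples of `Δ` are added on both sides, which avoids subtraction.
  _≋_ : ℕ → ℕ → Set
  m ≋ n = ∃[ i ] ∃[ j ] m + i * Δ ≡ n + j * Δ

  ≋-reflexive : ∀ {m n} → m ≡ n → m ≋ n
  ≋-reflexive refl = 0 , 0 , refl

  ≋-sym : ∀ {m n} → m ≋ n → n ≋ m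
  ≋-sym (i , j , eq) = j , i , sym eq

  +-cong-≋ : ∀ {m n o p} → m ≋ n → o ≋ p → m + o ≋ n + p
  +-cong-≋ {m} {n} {o} {p} (i , j , eq) (i′ , j′ , eq′) = i + i′ , j + j′ , (begin
    m + o + (i + i′) * Δ        ≡⟨ regroup m o i i′ Δ ⟩
    (m + i * Δ) + (o + i′ * Δ)  ≡⟨ cong₂ _+_ eq eq′ ⟩
    (n + j * Δ) + (p + j′ * Δ)  ≡⟨ regroup n p j j′ Δ ⟨
    n + p + (j + j′) * Δ        ∎)
    where
    open ≡-Reasoning
    regroup : ∀ m o i i′ Δ → m + o + (i + i′) * Δ ≡ (m + i * Δ) + (o + i′ * Δ)
    regroup = solve-∀

  +-cancelˡ-≋ : ∀ c {m n} → c + m ≋ c + n → m ≋ n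
  +-cancelˡ-≋ c {m} {n} (i , j , eq) = i , j ,
    +-cancelˡ-≡ c _ _ (trans (sym (+-assoc c m _)) (trans eq (+-assoc c n _)))

  ≋-trans : ∀ {m n o} → m ≋ n → n ≋ o → m ≋ o
  ≋-trans {m} {n} {o} p q = +-cancelˡ-≋ n
    (subst₂ _≋_ (+-comm m n) refl (+-cong-≋ p q))

  ≋0⇒≡0 : ∀ {m} → m < Δ → m ≋ 0 → m ≡ 0
  ≋0⇒≡0 {zero}  _   _            = refl
  ≋0⇒≡0 {suc m} m<Δ (i , j , eq) = contradiction
    (∣m+n∣m⇒∣n {n = suc m} (divides j (trans (+-comm (i * Δ) _) eq)) (n∣m*n i))
    (>⇒∤ m<Δ)

  ≋⇒≡ : ∀ {m n} → m < Δ → n < Δ → m ≋ n → m ≡ n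
  ≋⇒≡ {m} {n} m<Δ n<Δ (i , j , eq) = begin
    m                ≡⟨ m<n⇒m%n≡m m<Δ ⟨
    m % Δ            ≡⟨ [m+kn]%n≡m%n m i Δ ⟨
    (m + i * Δ) % Δ  ≡⟨ cong (_% Δ) eq ⟩
    (n + j * Δ) % Δ  ≡⟨ [m+kn]%n≡m%n n j Δ ⟩
    n % Δ            ≡⟨ m<n⇒m%n≡m n<Δ ⟩
    n                ∎
    where
    open ≡-Reasoning
    instance
      Δ≢0 : NonZero Δ
      Δ≢0 = >-nonZero (≤-<-trans z≤n m<Δ)

  -- Write δ for the sum of the six excesses over the minimal (for t, s) resp.
  -- below the maximal (for r, q) differences.  The congruences give δ ≋ 0, the
  -- bounds give δ ≤ 4k < Δ; so δ = 0 and all the differences are forced.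
  forced-meeting : ∀ j → let k = suc (j + j) in 4 * k < Δ →
    ∀ {t₀ t₁ t₂ s₀ s₁ s₂ r₀ r₁ q₀ q₁} →
    t₀ + suc j ≤ t₁ → t₁ + suc j ≤ t₂ → t₂ ≤ t₀ + (1 + k + k) →
    s₀ + suc j ≤ s₁ → s₁ + suc j ≤ s₂ → s₂ ≤ s₀ + (1 + k + k) →
    r₀ < r₁ → r₁ ≤ r₀ + suc k → q₀ < q₁ → q₁ ≤ q₀ + suc k →
    t₀ ≋ r₀ → s₂ ≋ r₁ → s₀ ≋ q₀ → t₂ ≋ q₁ → t₁ ≋ s₁
  forced-meeting j 4k<Δ {t₀} {s₀ = s₀} {r₀ = r₀} {r₁} {q₀} {q₁}
      t₀₁ t₁₂ t₂≤ s₀₁ s₁₂ s₂≤ r₀<r₁ r₁≤ q₀<q₁ q₁≤ t≋r s≋r s≋q t≋q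
    with α₁ , refl ← m≤n⇒∃[o]m+o≡n t₀₁ | β₁ , refl ← m≤n⇒∃[o]m+o≡n s₀₁
    with α₂ , refl ← m≤n⇒∃[o]m+o≡n t₁₂ | β₂ , refl ← m≤n⇒∃[o]m+o≡n s₁₂
    with ρ , r-eq ← m≤n⇒∃[o]m+o≡n r₁≤ | κ , q-eq ← m≤n⇒∃[o]m+o≡n q₁≤
    = meeting
    where
    k = suc (j + j)
    δ = ((α₁ + α₂) + (β₁ + β₂)) + (ρ + κ)

    excess≤ : ∀ a {α α′} → a + suc j + α + suc j + α′ ≤ a + (1 + k + k) → α + α′ ≤ k
    excess≤ a {α} {α′} le = +-cancelˡ-≤ (a + suc k) _ _
      (subst₂ _≤_ (lhs a j α α′) (rhs a j) le)
      where
      lhs : ∀ a j α α′ → a + suc j + α + suc j + α′ ≡ a + suc (suc (j + j)) + (α + α′)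
      lhs = solve-∀
      rhs : ∀ a j → a + (1 + suc (j + j) + suc (j + j)) ≡ a + suc (suc (j + j)) + suc (j + j)
      rhs = solve-∀

    defect≤ : ∀ a {b ρ} → a < b → b + ρ ≡ a + suc k → ρ ≤ k
    defect≤ a {b} {ρ} a<b eq = +-cancelˡ-≤ (suc a) _ _
      (≤-trans (+-monoˡ-≤ ρ a<b) (≤-reflexive (trans eq (+-suc a k))))

    δ<Δ : δ < Δ
    δ<Δ = ≤-<-trans
      (+-mono-≤ (+-mono-≤ (excess≤ t₀ t₂≤) (excess≤ s₀ s₂≤))
                (+-mono-≤ (defect≤ r₀ r₀<r₁ r-eq) (defect≤ q₀ q₀<q₁ q-eq)))
      (subst (_< Δ) (four k) 4k<Δ)
      where
      four : ∀ k → 4 * k ≡ k + k + (k + k)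
      four = solve-∀

    t₁ = t₀ + suc j + α₁
    t₂ = t₁ + suc j + α₂
    s₁ = s₀ + suc j + β₁
    s₂ = s₁ + suc j + β₂
    total = t₀ + s₀ + (r₀ + q₀) + (suc k + suc k)

    δ≋0 : δ ≋ 0
    -- The four congruences are added, those between first times reversed. Once `ρ + κ` is added
    -- too, the left side is `total + δ` and the right side is `total`.
    δ≋0 = +-cancelˡ-≋ total
      (subst₂ _≋_ (expand t₀ s₀ r₀ q₀ j α₁ α₂ β₁ β₂ ρ κ) collect
        (+-cong-≋ (+-cong-≋ (+-cong-≋ s≋r t≋q) (+-cong-≋ (≋-sym t≋r) (≋-sym s≋q)))
                  (≋-reflexive {ρ + κ} refl)))
      where
      expand : ∀ t₀ s₀ r₀ q₀ j α₁ α₂ β₁ β₂ ρ κ →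
        ((s₀ + suc j + β₁ + suc j + β₂) + (t₀ + suc j + α₁ + suc j + α₂)) + (r₀ + q₀) + (ρ + κ)
        ≡ t₀ + s₀ + (r₀ + q₀) + (suc (suc (j + j)) + suc (suc (j + j)))
          + (((α₁ + α₂) + (β₁ + β₂)) + (ρ + κ))
      expand = solve-∀

      regroup : ∀ r₁ q₁ t₀ s₀ ρ κ →
        (r₁ + q₁) + (t₀ + s₀) + (ρ + κ) ≡ (r₁ + ρ) + (q₁ + κ) + (t₀ + s₀)
      regroup = solve-∀

      regroup′ : ∀ r₀ q₀ t₀ s₀ K →
        (r₀ + K) + (q₀ + K) + (t₀ + s₀) ≡ t₀ + s₀ + (r₀ + q₀) + (K + K) + 0
      regroup′ = solve-∀

      collect : (r₁ + q₁) + (t₀ + s₀) + (ρ + κ) ≡ total + 0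
      collect = trans (regroup r₁ q₁ t₀ s₀ ρ κ)
        (trans (cong₂ (λ a b → a + b + (t₀ + s₀)) r-eq q-eq)
               (regroup′ r₀ q₀ t₀ s₀ (suc k)))

    δ≡0 : δ ≡ 0
    δ≡0 = ≋0⇒≡0 δ<Δ δ≋0

    αβ≡0 : (α₁ + α₂) + (β₁ + β₂) ≡ 0
    αβ≡0 = m+n≡0⇒m≡0 _ δ≡0

    -- The middle times are compared through `y` and `y′` alone, so three of the six summands
    -- suffice.
    α₂≡0 : α₂ ≡ 0
    α₂≡0 = m+n≡0⇒n≡0 α₁ (m+n≡0⇒m≡0 _ αβ≡0)

    β₁≡0 : β₁ ≡ 0
    β₁≡0 = m+n≡0⇒m≡0 β₁ (m+n≡0⇒n≡0 (α₁ + α₂) αβ≡0)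

    κ≡0 : κ ≡ 0
    κ≡0 = m+n≡0⇒n≡0 ρ (m+n≡0⇒n≡0 ((α₁ + α₂) + (β₁ + β₂)) δ≡0)

    q₁≡ : q₁ ≡ q₀ + suc k
    q₁≡ = trans (sym (trans (cong (q₁ +_) κ≡0) (+-identityʳ q₁))) q-eq

    meeting : t₁ ≋ s₁
    -- Now `t₁` lies `suc j` before `t₂ ≋ q₁`, and `s₁` lies `suc j` after `s₀ ≋ q₀`. As `k` is odd,
    -- the distance `suc k` from `q₀` to `q₁` is exactly twice `suc j`.
    meeting = +-cancelˡ-≋ (suc j) (≋-trans (≋-reflexive t-side)
      (≋-trans t≋q (≋-trans (≋-reflexive q₁≡)
        (≋-trans (+-cong-≋ (≋-sym s≋q) (≋-reflexive {suc k} refl)) (≋-reflexive s-side)))))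
      where
      t-side : suc j + t₁ ≡ t₂
      t-side = trans (+-comm (suc j) t₁)
        (trans (sym (+-identityʳ _)) (cong (t₁ + suc j +_) (sym α₂≡0)))
      shift : ∀ s j → s + suc (suc (j + j)) ≡ suc j + (s + suc j + 0)
      shift = solve-∀
      s-side : s₀ + suc k ≡ suc j + s₁
      s-side = trans (shift s₀ j) (cong (λ b → suc j + (s₀ + suc j + b)) (sym β₁≡0))

strictly-increasing-gap : ∀ {n} (τ : Fin n → ℕ) → (∀ {i j} → i Fin.< j → τ i < τ j) →
  ∀ {i j} d → toℕ j ≡ toℕ i + d → τ i + d ≤ τ j
strictly-increasing-gap τ inc {i} {j} zero eq = ≤-reflexive
  (trans (+-identityʳ (τ i)) (cong τ (toℕ-injective (sym (trans eq (+-identityʳ _))))))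
strictly-increasing-gap τ inc {i} {zero} (suc d) eq =
  contradiction (trans eq (+-suc (toℕ i) d)) (λ ())
strictly-increasing-gap τ inc {i} {suc j} (suc d) eq = begin
  τ i + suc d      ≡⟨ +-suc (τ i) d ⟩
  suc (τ i + d)    ≤⟨ s≤s (strictly-increasing-gap τ inc d
                       (trans (toℕ-inject₁ j) (suc-injective (trans eq (+-suc (toℕ i) d))))) ⟩
  suc (τ (inject₁ j)) ≤⟨ inc (s≤s (≤-reflexive (toℕ-inject₁ j))) ⟩
  τ (suc j)        ∎
  where open ≤-Reasoning

-- Paths towards the root of an orientation

-- A description by formulas of the only path from `s` to the root `z`. The function `site` is
-- total; its values beyond `L` are fillers.
record Route (G : Digraph) (s z : Digraph.Vertex G) (L : ℕ) : Set where
  field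
    parent   : ℕ → ℕ
    oriented : OrientedBy {G} parent
    root     : Digraph.order G ≤ parent (toℕ z)
    site     : ℕ → ℕ
    departs  : site 0 ≡ toℕ s
    climbs   : ∀ {i} → i < L → parent (site i) ≡ site (suc i)
    arrives  : site L ≡ toℕ z
    not-earlier : ∀ {i} → site i ≡ toℕ z → L ≤ i

module _ {G : Digraph} {s z : Digraph.Vertex G} {L : ℕ} (R : Route G s z L) where
  open Digraph G
  open Route R
  open Path

  -- Every step of a path to the root leads to the parent, so the start determines all its vertices
  -- in turn.
  path-on-route : ∀ {ℓ} (p : Path G s z ℓ) i → toℕ i ≤ L → toℕ (vertex p i) ≡ site (toℕ i)
  path-on-route p = <-weakInduction (λ i → toℕ i ≤ L → toℕ (vertex p i) ≡ site (toℕ i))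
    (λ _ → trans (cong toℕ (start p)) (sym departs))
    (λ i ih i<L → begin
      toℕ (vertex p (suc i))              ≡⟨ path-to-root-up parent oriented root p i ⟨
      parent (toℕ (vertex p (inject₁ i))) ≡⟨ cong parent (ih (≤-trans (≤-reflexive (toℕ-inject₁ i)) (<⇒≤ i<L))) ⟩
      parent (site (toℕ (inject₁ i)))     ≡⟨ cong (parent ∘ site) (toℕ-inject₁ i) ⟩
      parent (site (toℕ i))               ≡⟨ climbs i<L ⟩
      site (suc (toℕ i))                  ∎)
    where open ≡-Reasoning

  -- A shorter path would reach `z` before the route does; a longer one would visit `z` at position
  -- `L` and again at its end.
  path-length : ∀ {ℓ} → Path G s z ℓ → L ≡ ℓ
  path-length {ℓ} p with ≤-<-connex ℓ L
  ... | inj₁ ℓ≤L = ≤-antisym (not-earlier (begin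
    site ℓ                    ≡⟨ cong site (toℕ-fromℕ ℓ) ⟨
    site (toℕ (fromℕ ℓ))      ≡⟨ path-on-route p (fromℕ ℓ) (≤-trans (≤-reflexive (toℕ-fromℕ ℓ)) ℓ≤L) ⟨
    toℕ (vertex p (fromℕ ℓ))  ≡⟨ cong toℕ (end p) ⟩
    toℕ z                     ∎)) ℓ≤L
    where open ≡-Reasoning
  ... | inj₂ L<ℓ = trans (sym toℕ-at) (trans (cong toℕ at≡last) (toℕ-fromℕ ℓ))
    where
    at = fromℕ< (m<n⇒m<1+n L<ℓ)
    toℕ-at : toℕ at ≡ L
    toℕ-at = toℕ-fromℕ< (m<n⇒m<1+n L<ℓ)
    at≡last : at ≡ fromℕ ℓ
    at≡last = distinct p (toℕ-injective (begin
      toℕ (vertex p at)         ≡⟨ path-on-route p at (≤-reflexive toℕ-at) ⟩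
      site (toℕ at)             ≡⟨ cong site toℕ-at ⟩
      site L                    ≡⟨ arrives ⟩
      toℕ z                     ≡⟨ cong toℕ (end p) ⟨
      toℕ (vertex p (fromℕ ℓ))  ∎))
      where open ≡-Reasoning

-- Temporal paths along a route

module _ {Δ : ℕ} {G : Digraph} (lab : Labeling Δ G) where
  open Digraph G
  open Congruence Δ

  -- The ends are given by their numbers, so that arcs found on different paths can be compared
  -- through the sites of the routes.
  ActiveAt : ℕ → ℕ → ℕ → Set
  ActiveAt t m n = ∃[ u ] ∃[ v ] Σ[ e ∈ Arc u v ]
    toℕ u ≡ m × toℕ v ≡ n × Active lab {u} {v} e t

  activeAt-label : ∀ {u v} (e : Arc u v) → ActiveAt (toℕ (lab u v e)) (toℕ u) (toℕ v)
  activeAt-label e = _ , _ , e , refl , refl , 0 , sym (+-identityʳ _)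

  -- Both times are congruent to the label of the same arc. This links the temporal paths that share
  -- an arc.
  activeAt-≋ : ∀ {t t′ m n} → ActiveAt t m n → ActiveAt t′ m n → t ≋ t′
  activeAt-≋ (u , v , e , refl , refl , i , t≡) (u′ , v′ , e′ , u≡ , v≡ , i′ , t′≡)
    with refl ← toℕ-injective u≡ | refl ← toℕ-injective v≡
    with refl ← T-irrelevant e e′ =
    i′ , i , trans (cong (_+ i′ * Δ) t≡) (trans (swap-last (toℕ (lab u v e)) i i′ Δ) (cong (_+ i * Δ) (sym t′≡)))
    where
    swap-last : ∀ a i i′ Δ → a + i * Δ + i′ * Δ ≡ a + i′ * Δ + i * Δ
    swap-last = solve-∀

  -- What remains of a temporal path once its vertices and its length are fixed by the route.
  record Timetable {s z l} (R : Route G s z (suc l)) (d : ℕ) : Set where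
    open Route R
    field
      time       : Fin (suc l) → ℕ
      active     : ∀ i → ActiveAt (time i) (site (toℕ i)) (site (suc (toℕ i)))
      increasing : ∀ {i j} → i Fin.< j → time i < time j
      lasts      : (time (fromℕ l) + 1) ∸ time zero ≡ d

    gap : ∀ {i j} d → toℕ j ≡ toℕ i + d → time i + d ≤ time j
    gap = strictly-increasing-gap time increasing

    active-at : ∀ i {m n} → site (toℕ i) ≡ m → site (suc (toℕ i)) ≡ n → ActiveAt (time i) m n
    active-at i eq eq′ = subst₂ (ActiveAt (time i)) eq eq′ (active i)

    first≤last : time zero ≤ time (fromℕ l)
    first≤last = m+n≤o⇒m≤o (time zero) (gap l (toℕ-fromℕ l))

  timetable : ∀ {s z l} (R : Route G s z (suc l)) (q : TemporalPath lab s z) →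
              Timetable R (TemporalPath.duration q)
  timetable {l = l} R q with path-length R (TemporalPath.path q)
  ... | refl = record
    { time       = TemporalPath.time q
    ; active     = λ i → _ , _ , TemporalPath.arcs q i
        , trans (path-on-route R path (inject₁ i) (≤-trans (≤-reflexive (toℕ-inject₁ i)) (<⇒≤ (toℕ<n i))))
                (cong (Route.site R) (toℕ-inject₁ i))
        , path-on-route R path (suc i) (toℕ<n i)
        , TemporalPath.active q i
    ; increasing = TemporalPath.increasing q
    ; lasts      = refl
    }
    where path = TemporalPath.path q

  -- The labels themselves serve as times of a fastest path.
  fastest-on-route : ∀ {s z l} (R : Route G s z (suc l)) (label : ℕ → ℕ → ℕ) →
    (∀ {u v} (e : Arc u v) → toℕ (lab u v e) ≡ label (toℕ u) (toℕ v)) →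
    ∀ g → .{{NonZero g}} →
    (∀ {i} → i ≤ l → label (Route.site R i) (Route.site R (suc i)) ≡ i * g) →
    ∀ {ℓ} → Path G s z ℓ → ∀ {d} → l * g < d → FastestDurationAtMost lab s z d
  fastest-on-route {s} {z} {l} R label lab≡ g label≡ p l*g<d with path-length R p
  ... | refl = q , fastest , ≤-trans (≤-reflexive duration≡) l*g<d
    where
    open Route R

    onRoute : ∀ i → label (toℕ (Path.vertex p (inject₁ i))) (toℕ (Path.vertex p (suc i))) ≡ toℕ i * g
    onRoute i = trans
      (cong₂ label
        (trans (path-on-route R p (inject₁ i) (≤-trans (≤-reflexive (toℕ-inject₁ i)) (<⇒≤ (toℕ<n i))))
               (cong site (toℕ-inject₁ i)))
        (path-on-route R p (suc i) (toℕ<n i)))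
      (label≡ (s≤s⁻¹ (toℕ<n i)))

    q : TemporalPath lab s z
    q = record
      { path       = p
      ; time       = λ i → toℕ i * g
      ; active     = λ i → 0 , trans (sym (trans (lab≡ (Path.arcs p i)) (onRoute i))) (sym (+-identityʳ _))
      ; increasing = λ i<j → *-monoˡ-< g i<j
      }

    duration≡ : TemporalPath.duration q ≡ suc (l * g)
    duration≡ = trans (+-comm _ 1) (cong (λ n → suc (n * g)) (toℕ-fromℕ l))

    -- Every temporal path starts at a multiple of Δ and ends at l * g modulo Δ.
    fastest : IsFastest lab q
    fastest q′ = ≤-trans (≤-reflexive duration≡) (bound (timetable R q′))
      where
      residue : ∀ {t i} → i ≤ l → ActiveAt t (site i) (site (suc i)) → ∃[ c ] t ≡ i * g + c * Δ × i * g < Δ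
      residue i≤l (u , v , e , u≡ , v≡ , c , t≡) =
        c , trans t≡ (cong (_+ c * Δ) lab≡ig) , subst (_< Δ) lab≡ig (toℕ<n _)
        where lab≡ig = trans (lab≡ e) (trans (cong₂ label u≡ v≡) (label≡ i≤l))

      bound : ∀ {d} → Timetable R d → suc (l * g) ≤ d
      bound T with residue z≤n (Timetable.active T zero)
                 | residue (≤-reflexive (toℕ-fromℕ l)) (Timetable.active T (fromℕ l))
      ... | c , first≡ , _ | c′ , last≡ , last<Δ = begin
        suc (l * g)                             ≡⟨ m+n∸n≡m (suc (l * g)) (c * Δ) ⟨
        suc (l * g + c * Δ) ∸ c * Δ             ≤⟨ ∸-monoˡ-≤ (c * Δ) (s≤s (+-monoʳ-≤ (l * g) (*-monoˡ-≤ Δ c≤c′))) ⟩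
        suc (l * g + c′ * Δ) ∸ c * Δ            ≡⟨ cong (λ n → suc (n * g + c′ * Δ) ∸ c * Δ) (toℕ-fromℕ l) ⟨
        suc (toℕ (fromℕ l) * g + c′ * Δ) ∸ c * Δ ≡⟨ cong₂ (λ a b → suc a ∸ b) last≡ first≡ ⟨
        suc (time (fromℕ l)) ∸ time zero        ≡⟨ cong (_∸ time zero) (+-comm 1 (time (fromℕ l))) ⟩
        (time (fromℕ l) + 1) ∸ time zero        ≡⟨ lasts ⟩
        _ ∎
        where
        open Timetable T
        open ≤-Reasoning
        -- The last label is below `Δ`, so a last arc used in an earlier period than the first arc
        -- would precede it.
        c≤c′ : c ≤ c′
        c≤c′ = s≤s⁻¹ (*-cancelʳ-< Δ c (suc c′) (begin-strict
          c * Δ                       ≡⟨ first≡ ⟨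
          time zero                   ≤⟨ first≤last ⟩
          time (fromℕ l)              ≡⟨ last≡ ⟩
          toℕ (fromℕ l) * g + c′ * Δ  <⟨ +-monoˡ-< (c′ * Δ) last<Δ ⟩
          Δ + c′ * Δ                  ∎))

-- The gadget

-- The vertices are numbered x = 0, y′ = 1, x′ = 2, p_i = 3 + i, y = 4 + k.
module Gadget (k : ℕ) where

  -- The numbers from 2 to `4 + k` run along the path from `x′` to `y`, where the parent is the
  -- successor; 0 and 1 hang on its second and its second to last vertex. Rooted at `y`, the tree
  -- has increasing parents.
  towards-y : ℕ → ℕ
  towards-y 0             = 3
  towards-y 1             = 3 + k
  towards-y (suc (suc i)) = 3 + i

  -- x′ = 2 is the root; 5 + k is not a vertex.
  towards-x′ : ℕ → ℕ
  towards-x′ 0                   = 3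
  towards-x′ 1                   = 3 + k
  towards-x′ 2                   = 5 + k
  towards-x′ (suc (suc (suc i))) = 2 + i

  towards-y-inc : ∀ u → u < towards-y u
  towards-y-inc 0             = s≤s z≤n
  towards-y-inc 1             = s≤s (s≤s z≤n)
  towards-y-inc (suc (suc i)) = ≤-refl

  towards-y-bound : ∀ {u} → u < 4 + k → towards-y u ≤ 4 + k
  towards-y-bound {0}           _   = s≤s (s≤s (s≤s z≤n))
  towards-y-bound {1}           _   = n≤1+n (3 + k)
  towards-y-bound {suc (suc i)} u<n = u<n

  open ParentTree (4 + k) towards-y towards-y-inc towards-y-bound

  V : Set
  V = Fin (5 + k)

  x x′ y y′ : V
  x  = zero
  y′ = suc zero
  x′ = suc (suc zero)
  y  = fromℕ (4 + k)

  demand : ℕ⁺∞ → ℕ⁺∞ → V → ℕ⁺∞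
  demand to-x′ to-y v with v ≟ x′
  ... | yes _ = to-x′
  ... | no  _ with v ≟ y
  ...   | yes _ = to-y
  ...   | no  _ = ∞

  near far : ℕ⁺∞
  near = fin (2 + k)
  far  = fin (2 + k + k)

  bound : V → V → ℕ⁺∞
  bound zero          = demand near far
  bound (suc zero)    = demand far near
  bound (suc (suc _)) = λ _ → ∞

  demand-elim : ∀ {a b} (P : V → ℕ⁺∞ → Set) → P x′ a → P y b → (∀ v → P v ∞) →
                ∀ v → P v (demand a b v)
  demand-elim P Pa Pb P∞ v with v ≟ x′
  ... | yes refl = Pa
  ... | no  _ with v ≟ y
  ...   | yes refl = Pb
  ...   | no  _    = P∞ v

  -- Reduces the slack condition and validity, both trivial at `∞`, to the four finite bounds.
  bound-elim : (P : V → V → ℕ⁺∞ → Set) →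
               P x x′ near → P x y far → P y′ x′ far → P y′ y near → (∀ u v → P u v ∞) →
               ∀ u v → P u v (bound u v)
  bound-elim P xx′ xy y′x′ y′y P∞ zero          = demand-elim (P x) xx′ xy (P∞ x)
  bound-elim P xx′ xy y′x′ y′y P∞ (suc zero)    = demand-elim (P y′) y′x′ y′y (P∞ y′)
  bound-elim P xx′ xy y′x′ y′y P∞ (suc (suc u)) = P∞ (suc (suc u))

  -- The test `y ≟ y` does not compute for a variable `k`, unlike the comparison with `x′`.
  demand-y : ∀ a b → demand a b y ≡ b
  demand-y a b with y ≟ y
  ... | yes _  = refl
  ... | no y≢y = contradiction refl y≢y

  gadget : Instance
  gadget = record { graph = graph ; isTree = isTree ; D = bound }

  G : Digraph
  G = bidirected graph

  -- Moving the root from `y` to `x′` reverses exactly the edges on the path between them.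
  oriented-x′ : OrientedBy {G} towards-x′
  oriented-x′ {u} {v} e = [ reorient (toℕ u) , swap ∘ reorient (toℕ v) ]′ (oriented {u} {v} e)
    where
    reorient : ∀ a {b} → towards-y a ≡ b → towards-x′ a ≡ b ⊎ towards-x′ b ≡ a
    reorient 0             refl = inj₁ refl
    reorient 1             refl = inj₁ refl
    reorient (suc (suc i)) refl = inj₂ refl

  root-y : 5 + k ≤ towards-y (toℕ y)
  root-y = ≤-reflexive (cong (3 +_) (cong (2 +_) (sym (toℕ-fromℕ k))))

  toℕ-y : 4 + k ≡ toℕ y
  toℕ-y = sym (toℕ-fromℕ (4 + k))

  route-xy : Route G x y (2 + k)
  route-xy = record
    { parent = towards-y ; oriented = λ {u} {v} → oriented {u} {v} ; root = root-y
    ; site = λ { 0 → 0 ; (suc i) → 3 + i }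
    ; departs = refl
    ; climbs = λ { {0} _ → refl ; {suc i} _ → refl }
    ; arrives = toℕ-y
    ; not-earlier = λ { {0} () ; {suc i} eq → s≤s (≤-reflexive
        (+-cancelˡ-≡ 3 _ _ (sym (trans eq (sym toℕ-y))))) }
    }

  route-y′y : Route G y′ y 2
  route-y′y = record
    { parent = towards-y ; oriented = λ {u} {v} → oriented {u} {v} ; root = root-y
    ; site = λ { 0 → 1 ; (suc i) → 3 + (i + k) }
    ; departs = refl
    ; climbs = λ { {0} _ → refl ; {suc i} _ → refl }
    ; arrives = toℕ-y
    ; not-earlier = λ { {0} () ; {suc i} eq → s≤s (≤-reflexive
        (+-cancelʳ-≡ k _ _ (sym (+-cancelˡ-≡ 3 _ _ (trans eq (sym toℕ-y)))))) }
    }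

  route-xx′ : Route G x x′ 2
  route-xx′ = record
    { parent = towards-x′ ; oriented = λ {u} {v} → oriented-x′ {u} {v} ; root = ≤-refl
    ; site = λ { 0 → 0 ; 1 → 3 ; (suc (suc _)) → 2 }
    ; departs = refl
    ; climbs = λ { {0} _ → refl ; {1} _ → refl ; {suc (suc _)} (s≤s (s≤s ())) }
    ; arrives = refl
    ; not-earlier = λ { {0} () ; {1} () ; {suc (suc i)} _ → s≤s (s≤s z≤n) }
    }

  route-y′x′ : Route G y′ x′ (2 + k)
  route-y′x′ = record
    { parent = towards-x′ ; oriented = λ {u} {v} → oriented-x′ {u} {v} ; root = ≤-refl
    ; site = λ { 0 → 1 ; (suc i) → (3 + k) ∸ i }
    ; departs = refl
    ; climbs = λ { {0} _ → refl ; {suc i} (s≤s i≤k) → climb (s≤s⁻¹ i≤k) }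
    ; arrives = m+n∸n≡m 2 (suc k)
    ; not-earlier = λ { {0} () ; {suc i} eq → s≤s (late i eq) }
    }
    where
    climb : ∀ {i} → i ≤ k → towards-x′ ((3 + k) ∸ i) ≡ (2 + k) ∸ i
    climb {i} i≤k rewrite +-∸-assoc 3 i≤k | +-∸-assoc 2 i≤k = refl

    late : ∀ i → (3 + k) ∸ i ≡ 2 → suc k ≤ i
    late i eq = +-cancelˡ-≤ 2 _ _ (≤-trans (m≤n+m∸n (3 + k) i)
      (≤-reflexive (trans (cong (i +_) eq) (+-comm i 2))))

  hasSlack : HasSlack gadget k
  hasSlack u v u≢v d dist = bound-elim
    (λ u v b → IsDistance G u v d → (d + k) ≤∞ b)
    (within route-xx′) (within route-xy) (within route-y′x′) (within route-y′y)
    (λ _ _ _ → tt) u v dist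
    where
    within : ∀ {s z L} → Route G s z L → IsDistance G s z d → d + k ≤ L + k
    within R (p , _) = +-monoˡ-≤ k (≤-reflexive (sym (path-length R p)))

  -- The labels 0, 1, …, k + 1 in this order along both long routes.
  label : ℕ → ℕ → ℕ
  label 0             _ = 0
  label 1             _ = 0
  label (suc (suc i)) v = if v ≡ᵇ 3 + i then i else (2 + k) ∸ i

  label≤ : ∀ u v → u < 5 + k → label u v ≤ 2 + k
  label≤ 0             _ _ = z≤n
  label≤ 1             _ _ = z≤n
  label≤ (suc (suc i)) v u<n with v ≡ᵇ 3 + i
  ... | true  = s≤s⁻¹ (s≤s⁻¹ (s≤s⁻¹ u<n))
  ... | false = m∸n≤m (2 + k) i

  label-up : ∀ i → label (2 + i) (3 + i) ≡ i
  label-up i rewrite Equivalence.to T-≡ (≡⇒≡ᵇ i i refl) = refl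

  label-down : ∀ i → label (3 + i) (2 + i) ≡ (1 + k) ∸ i
  label-down i with i ≡ᵇ 2 + i in eq
  ... | false = refl
  ... | true  = contradiction (≡ᵇ⇒≡ i (2 + i) (Equivalence.from T-≡ eq)) (m≢1+n+m i)

  -- The long paths never wait, so they last `2 + k`. The short ones use the labels 0 and `suc k`,
  -- hence the step `suc k`, and exhaust the bound `near`.
  realizable : ∀ {Δ} → 2 + k < Δ → Realizable gadget Δ
  realizable {Δ} 2+k<Δ = lab , λ u v _ → bound-elim (Respects gadget lab)
    (fastest route-xx′  (suc k) xx′  (connected x x′)  (≤-reflexive (cong suc (*-identityˡ (suc k)))))
    (fastest route-xy   1       xy   (connected x y)   long)
    (fastest route-y′x′ 1       y′x′ (connected y′ x′) long)
    (fastest route-y′y  (suc k) y′y  (connected y′ y)  (≤-reflexive (cong suc (*-identityˡ (suc k)))))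
    (λ _ _ → tt) u v
    where
    open IsTree isTree using (connected)

    label<Δ : ∀ (u v : V) → label (toℕ u) (toℕ v) < Δ
    label<Δ u v = ≤-<-trans (label≤ (toℕ u) (toℕ v) (toℕ<n u)) 2+k<Δ

    lab : Labeling Δ G
    lab u v _ = fromℕ< (label<Δ u v)

    fastest : ∀ {s z l} (R : Route G s z (suc l)) g → .{{_ : NonZero g}} →
      (∀ {i} → i ≤ l → label (Route.site R i) (Route.site R (suc i)) ≡ i * g) →
      ∃[ ℓ ] Path G s z ℓ → ∀ {d} → l * g < d → FastestDurationAtMost lab s z d
    fastest R g labels (_ , p) =
      fastest-on-route lab R label (λ {u} {v} _ → toℕ-fromℕ< (label<Δ u v)) g labels p

    long : suc k * 1 < 2 + k + k
    long = s≤s (≤-trans (≤-reflexive (*-identityʳ (suc k))) (s≤s (m≤m+n k k)))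

    xx′ : ∀ {i} → i ≤ 1 → label (Route.site route-xx′ i) (Route.site route-xx′ (suc i)) ≡ i * suc k
    xx′ z≤n       = refl
    xx′ (s≤s z≤n) = sym (*-identityˡ (suc k))

    y′y : ∀ {i} → i ≤ 1 → label (Route.site route-y′y i) (Route.site route-y′y (suc i)) ≡ i * suc k
    y′y z≤n       = refl
    y′y (s≤s z≤n) = trans (label-up (suc k)) (sym (*-identityˡ (suc k)))

    xy : ∀ {i} → i ≤ suc k → label (Route.site route-xy i) (Route.site route-xy (suc i)) ≡ i * 1
    xy {zero}  _ = refl
    xy {suc i} _ = trans (label-up (suc i)) (sym (*-identityʳ (suc i)))

    y′x′ : ∀ {i} → i ≤ suc k → label (Route.site route-y′x′ i) (Route.site route-y′x′ (suc i)) ≡ i * 1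
    y′x′ {zero}  _         = refl
    y′x′ {suc i} (s≤s i≤k) rewrite +-∸-assoc 3 i≤k | +-∸-assoc 2 i≤k | *-identityʳ i = begin
      label (3 + (k ∸ i)) (2 + (k ∸ i))  ≡⟨ label-down (k ∸ i) ⟩
      (1 + k) ∸ (k ∸ i)                  ≡⟨ +-∸-assoc 1 (m∸n≤m k i) ⟩
      1 + (k ∸ (k ∸ i))                  ≡⟨ cong suc (m∸[m∸n]≡n i≤k) ⟩
      suc i                              ∎
      where open ≡-Reasoning

-- Equal labels on the middle edge

module _ (j : ℕ) where
  private
    k : ℕ
    k = suc (j + j)

  open Gadget k
  open Instance gadget using (Arc; Vertex)
  open ParentTree (4 + k) towards-y towards-y-inc towards-y-bound using (parent⇒edge)

  middle-enforced : ∀ {Δ} → 4 * k < Δ → ∃[ v₁ ] ∃[ v₂ ] ∃[ e ] EnforcesEqual gadget Δ v₁ v₂ e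
  middle-enforced {Δ} 4k<Δ = v₁ , v₂ , e , enforced
    where
    j<k : j < k
    j<k = s≤s (m≤m+n j j)

    v₁< : 3 + j < 5 + k
    v₁< = +-mono-≤-< (n≤1+n 3) (m<n⇒m<1+n j<k)

    v₂< : 4 + j < 5 + k
    v₂< = +-mono-≤-< (n≤1+n 4) j<k

    -- These are p_j and p_(j+1), the two middle vertices of the path p₀ ... p_k.
    v₁ v₂ : Vertex
    v₁ = fromℕ< v₁<
    v₂ = fromℕ< v₂<

    e : Arc v₁ v₂
    e = parent⇒edge {v₁} {v₂} (inj₁ (trans (cong towards-y (toℕ-fromℕ< v₁<)) (sym (toℕ-fromℕ< v₂<))))

    enforced : EnforcesEqual gadget Δ v₁ v₂ e
    enforced lab valid = toℕ-injective (≋⇒≡ (toℕ<n _) (toℕ<n _)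
      (≋-trans (activeAt-≋ lab
                 (subst₂ (ActiveAt lab _) (toℕ-fromℕ< v₁<) (toℕ-fromℕ< v₂<) (activeAt-label lab e))
                 (XY.active-at mid (cong (Route.site route-xy) toℕ-mid) (cong (3 +_) toℕ-mid)))
      (≋-trans meet
               (activeAt-≋ lab
                 (Y′X′.active-at mid site-mid site-mid′)
                 (subst₂ (ActiveAt lab _) (toℕ-fromℕ< v₂<) (toℕ-fromℕ< v₁<)
                   (activeAt-label lab (Instance.symm gadget {v₁} {v₂} e)))))))
      where
      open Congruence Δ

      q-xy   = subst (Respects gadget lab x y) (demand-y near far) (valid x y (λ ()))
      q-y′y  = subst (Respects gadget lab y′ y) (demand-y far near) (valid y′ y (λ ()))
      q-xx′  = valid x x′ (λ ())
      q-y′x′ = valid y′ x′ (λ ())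

      module XY   = Timetable (timetable lab route-xy (proj₁ q-xy))
      module Y′Y  = Timetable (timetable lab route-y′y (proj₁ q-y′y))
      module XX′  = Timetable (timetable lab route-xx′ (proj₁ q-xx′))
      module Y′X′ = Timetable (timetable lab route-y′x′ (proj₁ q-y′x′))

      mid< : suc j < 2 + k
      mid< = s≤s (m<n⇒m<1+n j<k)

      -- Both long paths have `2 + k` arcs, with `suc j` of them on either side of this one.
      mid : Fin (2 + k)
      mid = fromℕ< mid<

      toℕ-mid : toℕ mid ≡ suc j
      toℕ-mid = toℕ-fromℕ< mid<

      end-mid : toℕ (fromℕ (suc k)) ≡ toℕ mid + suc j
      end-mid = trans (toℕ-fromℕ (suc k))
        (trans (cong suc (sym (+-suc j j))) (cong (_+ suc j) (sym toℕ-mid)))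

      site-mid : Route.site route-y′x′ (toℕ mid) ≡ 4 + j
      site-mid = trans (cong (Route.site route-y′x′) toℕ-mid) (m+n∸n≡m (4 + j) j)

      site-mid′ : Route.site route-y′x′ (suc (toℕ mid)) ≡ 3 + j
      site-mid′ = trans (cong (Route.site route-y′x′ ∘ suc) toℕ-mid) (m+n∸n≡m (3 + j) j)

      -- A duration is one more than the difference between last and first time.
      last≤ : ∀ {b a d} → a ≤ b → (b + 1) ∸ a ≤ suc d → b ≤ a + d
      last≤ {b} {a} {d} a≤b le = s≤s⁻¹ (begin
        suc b                  ≡⟨ +-comm 1 b ⟩
        b + 1                  ≡⟨ m+[n∸m]≡n (≤-trans a≤b (m≤m+n b 1)) ⟨
        a + ((b + 1) ∸ a)      ≤⟨ +-monoʳ-≤ a le ⟩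
        a + suc d              ≡⟨ +-suc a d ⟩
        suc (a + d)            ∎)
        where open ≤-Reasoning

      meet : XY.time mid ≋ Y′X′.time mid
      meet = forced-meeting j 4k<Δ
        (XY.gap (suc j) toℕ-mid) (XY.gap (suc j) end-mid)
        (last≤ XY.first≤last (≤-trans (≤-reflexive XY.lasts) (proj₂ (proj₂ q-xy))))
        (Y′X′.gap (suc j) toℕ-mid) (Y′X′.gap (suc j) end-mid)
        (last≤ Y′X′.first≤last (≤-trans (≤-reflexive Y′X′.lasts) (proj₂ (proj₂ q-y′x′))))
        (XX′.increasing {zero} {suc zero} (s≤s z≤n))
        (last≤ XX′.first≤last (≤-trans (≤-reflexive XX′.lasts) (proj₂ (proj₂ q-xx′))))
        (Y′Y.increasing {zero} {suc zero} (s≤s z≤n))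
        (last≤ Y′Y.first≤last (≤-trans (≤-reflexive Y′Y.lasts) (proj₂ (proj₂ q-y′y))))
        -- The arcs shared by a long and a short path, in this order: x → p₀, p₀ → x′, y′ → p_k and
        -- p_k → y.
        (activeAt-≋ lab (XY.active zero) (XX′.active zero))
        (activeAt-≋ lab
          (Y′X′.active-at (fromℕ (suc k))
            (trans (cong (Route.site route-y′x′) (toℕ-fromℕ (suc k))) (m+n∸n≡m 3 k))
            (trans (cong (Route.site route-y′x′ ∘ suc) (toℕ-fromℕ (suc k))) (m+n∸n≡m 2 k)))
          (XX′.active (suc zero)))
        (activeAt-≋ lab (Y′X′.active zero) (Y′Y.active zero))
        (activeAt-≋ lab
          (XY.active-at (fromℕ (suc k))
            (cong (Route.site route-xy) (toℕ-fromℕ (suc k)))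
            (cong (3 +_) (toℕ-fromℕ (suc k))))
          (Y′Y.active (suc zero)))

-- Odd and even slack

odd⇒1+j+j : ∀ k → 2 ∤ k → ∃[ j ] k ≡ suc (j + j)
odd⇒1+j+j 0 2∤k = contradiction (divides 0 refl) 2∤k
odd⇒1+j+j 1 2∤k = 0 , refl
odd⇒1+j+j (suc (suc k)) 2∤k
  with odd⇒1+j+j k (λ { (divides i eq) → 2∤k (divides (suc i) (cong (2 +_) eq)) })
... | j , refl = suc j , cong (2 +_) (sym (+-suc j j))

isGadget : ∀ Δ k → 2 ∤ k → 4 * k + 1 ≤ Δ → IsGadget (Gadget.gadget k) Δ k
isGadget Δ k 2∤k 4k+1≤Δ with odd⇒1+j+j k 2∤k
... | j , refl = Gadget.hasSlack k , Gadget.realizable k 2+k<Δ , middle-enforced j 4k<Δ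
  where
  4k<Δ : 4 * k < Δ
  4k<Δ = subst (_≤ Δ) (+-comm (4 * k) 1) 4k+1≤Δ

  2+k≤4k : ∀ m → 2 + suc m ≤ 4 * suc m
  2+k≤4k m = ≤-trans (m≤m+n _ (1 + 3 * m)) (≤-reflexive (expand m))
    where
    expand : ∀ m → 2 + suc m + (1 + 3 * m) ≡ 4 * suc m
    expand = solve-∀

  2+k<Δ : 2 + k < Δ
  2+k<Δ = ≤-<-trans (2+k≤4k (j + j)) 4k<Δ

≤∞-weaken : ∀ {m n} b → m ≤ n → n ≤∞ b → m ≤∞ b
≤∞-weaken (fin _) m≤n n≤d = ≤-trans m≤n n≤d
≤∞-weaken ∞       _   _   = tt

lemma15 : Σ[ G ∈ (ℕ → ℕ → Instance) ]
    ((Δ k : ℕ) → 1 ≤ k → 2 ∤ k → 4 * k + 1 ≤ Δ → IsGadget (G Δ k) Δ k)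
    × ((Δ k : ℕ) → 2 ∣ k → 4 * k + 5 ≤ Δ → IsGadget (G Δ (k + 1)) Δ k)
lemma15 = (λ _ k → Gadget.gadget k) , (λ Δ k _ → isGadget Δ k) , even
  where
  shift : ∀ k → 4 * (k + 1) + 1 ≡ 4 * k + 5
  shift = solve-∀

  -- Slack `k + 1` implies slack `k`, while realizability and enforcement do not refer to the slack
  -- and carry over as `rest`. The bound on `Δ` is the odd one at `k + 1`.
  even : ∀ Δ k → 2 ∣ k → 4 * k + 5 ≤ Δ → IsGadget (Gadget.gadget (k + 1)) Δ k
  even Δ k 2∣k 4k+5≤Δ
    with slack , rest ← isGadget Δ (k + 1)
           (λ 2∣k+1 → >⇒∤ (s≤s (s≤s z≤n)) (∣m+n∣m⇒∣n 2∣k+1 2∣k))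
           (≤-trans (≤-reflexive (shift k)) 4k+5≤Δ)
    = (λ u v u≢v d dist → ≤∞-weaken (Gadget.bound (k + 1) u v) (+-monoʳ-≤ d (m≤m+n k 1)) (slack u v u≢v d dist))
    , rest
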